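{- Let $n\geq 2$, and let $B$ be an $n\times n$ symmetric matrix over a field of characteristic $2$, with $\operatorname{epr}(B)=\ell_1\ell_2\cdots\ell_n$. Suppose that $\ell_{n-1}\ell_n=\mathtt{AN}$. Then every minor of $B$ of order $n-1$ (principal or not) is nonzero.
   Context: For an $n\times n$ symmetric matrix $B$ over a field $\mathbb{F}$, the enhanced principal rank characteristic sequence (epr-sequence) is $\operatorname{epr}(B)=\ell_1\ell_2\cdots\ell_n$, where $\ell_k=\mathtt{A}$ if all principal minors of $B$ of order $k$ are nonzero, $\ell_k=\mathtt{S}$ if some but not all principal minors of order $k$ are nonzero, and $\ell_k=\mathtt{N}$ if all principal minors of order $k$ are zero. -}

module Defs where

open import Algebra.Apartness.Bundles using (HeytingField; HeytingCommutativeRing)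
open import Algebra.Bundles using (CommutativeRing; Semiring)
import Algebra.Definitions.RawMonoid as RawMonoidDefs
import Algebra.Definitions.RawSemiring as RawSemiringDefs
open import Data.Fin.Base using (Fin; zero; suc; toℕ; punchIn; _<_)
open import Data.Nat.Base using (ℕ; zero; suc)
open import Data.Nat.Divisibility using (_∣_)
open import Data.Product.Base using (Σ-syntax; ∃-syntax; _×_; proj₁)
open import Data.Vec.Base using (Vec; lookup)
open import Function.Bundles using (_⇔_)
open import Level using (_⊔_)
open import Relation.Binary.Core using (_Preserves_⟶_)
open import Relation.Binary.PropositionalEquality.Core using (_≡_)
open import Relation.Nullary.Negation using (¬_)

data Letter : Set where
  A S N : Letter

-- The k-th term of a sequence of letters, numbered from 1, is a.
infix 4 _⟨_⟩≡_
_⟨_⟩≡_ : ∀ {n} → Vec Letter n → ℕ → Letter → Set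
ℓ ⟨ k ⟩≡ a = ∃[ i ] (suc (toℕ i) ≡ k × lookup ℓ i ≡ a)

-- A k-element subset of Fin n, given by its increasing enumeration.
IndexSet : ℕ → ℕ → Set
IndexSet k n = Σ[ f ∈ (Fin k → Fin n) ] (f Preserves _<_ ⟶ _<_)

module Determinant {c ℓ} (R : CommutativeRing c ℓ) where
  open CommutativeRing R hiding (zero)
  open RawMonoidDefs +-rawMonoid using (sum) renaming (_×_ to _·_)
  open RawSemiringDefs (Semiring.rawSemiring semiring) using (_^_)

  HasCharacteristic : ℕ → Set ℓ
  HasCharacteristic p = ∀ m → (m · 1# ≈ 0#) ⇔ (p ∣ m)

  Matrix : ℕ → ℕ → Set c
  Matrix m n = Fin m → Fin n → Carrier

  Symmetric : ∀ {n} → Matrix n n → Set ℓ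
  Symmetric B = ∀ i j → B i j ≈ B j i

  -- Laplace expansion along the first row.
  det : ∀ {n} → Matrix n n → Carrier
  det {zero}  B = 1#
  det {suc n} B = sum λ j →
    (- 1#) ^ toℕ j * (B zero j * det λ r s → B (suc r) (punchIn j s))

  minor : ∀ {k m n} → Matrix m n → IndexSet k m → IndexSet k n → Carrier
  minor B α β = det λ r s → B (proj₁ α r) (proj₁ β s)

  principalMinor : ∀ {k n} → Matrix n n → IndexSet k n → Carrier
  principalMinor B α = minor B α α

-- "x is nonzero" is x # 0#, the Heyting field's tight apartness from zero.
-- Classically _#_ is the negation of _≈_, and Heyting fields are exactly fields.
module EprSequence {c ℓ₁ ℓ₂} (F : HeytingField c ℓ₁ ℓ₂) where
  open HeytingField F
  open Determinant (HeytingCommutativeRing.commutativeRing heytingCommutativeRing) public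

  AllNonzero SomeNonzero : ∀ {n} → Matrix n n → ℕ → Set ℓ₂
  AllNonzero  {n} B k = (α : IndexSet k n) → principalMinor B α # 0#
  SomeNonzero {n} B k = Σ[ α ∈ IndexSet k n ] (principalMinor B α # 0#)

  AllZero : ∀ {n} → Matrix n n → ℕ → Set ℓ₁
  AllZero {n} B k = (α : IndexSet k n) → principalMinor B α ≈ 0#

  data HasLetter {n} (B : Matrix n n) (k : ℕ) : Letter → Set (ℓ₁ ⊔ ℓ₂) where
    all  : AllNonzero B k → HasLetter B k A
    some : SomeNonzero B k → ¬ AllNonzero B k → HasLetter B k S
    none : AllZero B k → HasLetter B k N

  -- epr(B) = ℓ is a relation, because computing the letters of epr(B) would
  -- require a decidable equality on the field.
  IsEpr : ∀ {n} → Matrix n n → Vec Letter n → Set (ℓ₁ ⊔ ℓ₂)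
  IsEpr B ℓ = ∀ i → HasLetter B (suc (toℕ i)) (lookup ℓ i)

{-# OPTIONS --safe #-}
module Submission where

-- In characteristic 2 all signs in Laplace expansions disappear, so determinants
-- may be replaced by permanents. Write m i k for the minor of B omitting row i
-- and column k. As det B = 0, each row v = m i and w = m j of the matrix of minors
-- lies in the kernel of B, hence so does u = w j · v + v j · w. Its j-th entry
-- vanishes, so the remaining entries form a kernel vector of the matrix obtained
-- from B by omitting row and column j, whose determinant is m j j. By Cramer's rule
-- m j j · u i = 0, that is m j j · (m j j · m i i) = m j j · (m i j · m j i), and
-- the left-hand side is nonzero.

open import Defs
open import Algebra.Apartness.Bundles using (HeytingField; HeytingCommutativeRing)
import Algebra.Apartness.Properties.HeytingCommutativeRing as HeytingProperties
open import Algebra.Bundles using (CommutativeRing; Semiring)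
import Algebra.Definitions.RawSemiring as RawSemiringDefs
import Algebra.Properties.CommutativeSemigroup as CommutativeSemigroupProperties
import Algebra.Properties.Semiring.Sum as SemiringSum
open import Data.Fin.Base using (Fin; zero; suc; toℕ; punchIn; punchOut; _<_)
open import Data.Fin.Properties
  using (_≟_; punchIn-cancel-≤; punchIn-punchOut; toℕ-injective)
open import Data.Nat.Base using (ℕ; zero; suc; _≤_; _∸_; z≤n; s≤s)
open import Data.Nat.Divisibility using (∣-refl)
open import Data.Nat.Properties using (<⇒≱; ≰⇒>; n≮0; n≤0⇒n≡0)
open import Data.Product.Base using (∃-syntax; _,_; proj₁; proj₂)
open import Data.Vec.Base using (Vec)
open import Data.Vec.Functional using (Vector; _∷_)
open import Function.Base using (_∘_; id)
open import Function.Bundles using (Equivalence)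
open import Relation.Binary.Core using (_Preserves_⟶_)
open import Relation.Binary.PropositionalEquality as ≡ using (_≡_; _≢_; _≗_)
import Relation.Binary.Reasoning.Setoid as ≈-Reasoning
open import Relation.Nullary.Decidable using (yes; no)

-- Increasing maps into finite sets.

punchIn-mono-< : ∀ {n} (i : Fin (suc n)) → punchIn i Preserves _<_ ⟶ _<_
punchIn-mono-< i {j} {k} j<k = ≰⇒> (<⇒≱ j<k ∘ punchIn-cancel-≤ i k j)

factorsThroughSuc : ∀ {k n} (f : Fin k → Fin (suc n)) → (∀ s → zero ≢ f s) →
                    ∃[ g ] (∀ s → f s ≡ suc (g s))
factorsThroughSuc f 0≢f =
  (λ s → punchOut (0≢f s)) , λ s → ≡.sym (punchIn-punchOut (0≢f s))

increasing⇒tail≢0 : ∀ {k n} (f : Fin (suc k) → Fin (suc n)) → f Preserves _<_ ⟶ _<_ →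
                    ∀ s → zero ≢ f (suc s)
increasing⇒tail≢0 f mono s eq =
  n≮0 (≡.subst (f zero <_) (≡.sym eq) (mono {zero} {suc s} (s≤s z≤n)))

suc-factor-increasing : ∀ {k n} {f : Fin k → Fin (suc n)} {g : Fin k → Fin n} →
                        (∀ s → f s ≡ suc (g s)) → f Preserves _<_ ⟶ _<_ →
                        g Preserves _<_ ⟶ _<_
suc-factor-increasing eq mono {s} {t} s<t with ≡.subst₂ _<_ (eq s) (eq t) (mono s<t)
... | s≤s gs<gt = gs<gt

-- The values after the first avoid zero, so the tail factors through `suc` and is fixed by
-- induction. Then `f zero` lies below `f (suc zero)`, which is one, and must be zero.
increasing-endo≗id : ∀ {n} (f : Fin n → Fin n) → f Preserves _<_ ⟶ _<_ → f ≗ id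
increasing-endo≗id {suc n} f mono =
  λ { zero → f0≡0 f mono f∘suc ; (suc s) → f∘suc s }
  where
  g = factorsThroughSuc (f ∘ suc) (increasing⇒tail≢0 f mono)
  f∘suc : ∀ s → f (suc s) ≡ suc s
  f∘suc s = ≡.trans (proj₂ g s) (≡.cong suc (increasing-endo≗id (proj₁ g)
    (suc-factor-increasing (proj₂ g) (mono ∘ s≤s)) s))
  f0≡0 : ∀ {n} (f : Fin (suc n) → Fin (suc n)) → f Preserves _<_ ⟶ _<_ →
         (∀ s → f (suc s) ≡ suc s) → f zero ≡ zero
  f0≡0 {zero} f _ _ with f zero
  ... | zero = ≡.refl
  f0≡0 {suc _} f mono f∘suc
    with ≡.subst (f zero <_) (f∘suc zero) (mono {zero} {suc zero} (s≤s z≤n))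
  ... | s≤s f0≤0 = toℕ-injective (n≤0⇒n≡0 f0≤0)

-- An index set missing one element is determined by that element. If `f zero` is not zero, the
-- whole image avoids zero and the missing element is zero; otherwise it is found in the tail.
increasing≗punchIn : ∀ {n} (f : Fin n → Fin (suc n)) → f Preserves _<_ ⟶ _<_ →
                     ∃[ i ] f ≗ punchIn i
increasing≗punchIn {zero} f mono = zero , λ ()
increasing≗punchIn {suc n} f mono with zero ≟ f zero
... | yes 0≡f0 =
  let g , eq = factorsThroughSuc (f ∘ suc) (increasing⇒tail≢0 f mono)
      i , g≗ = increasing≗punchIn g (suc-factor-increasing eq (mono ∘ s≤s))
  in suc i , λ { zero → ≡.sym 0≡f0 ; (suc s) → ≡.trans (eq s) (≡.cong suc (g≗ s)) }
... | no 0≢f0 =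
  let g , eq = factorsThroughSuc f
        (λ { zero → 0≢f0 ; (suc s) → increasing⇒tail≢0 f mono s })
  in zero , λ s →
    ≡.trans (eq s) (≡.cong suc (increasing-endo≗id g (suc-factor-increasing eq mono) s))

-- Permanents and Laplace expansion in characteristic 2.

module Permanent {c ℓ} (R : CommutativeRing c ℓ) where
  open CommutativeRing R hiding (zero)
  open Determinant R using (Matrix; Symmetric; HasCharacteristic; det)
  open RawSemiringDefs (Semiring.rawSemiring semiring) using (_^_)
  open SemiringSum semiring
  open CommutativeSemigroupProperties *-commutativeSemigroup
    using () renaming (x∙yz≈y∙xz to x*yz≈y*xz; x∙yz≈z∙yx to x*yz≈z*yx)
  open ≈-Reasoning setoid

  sum-zero : ∀ {n} {f : Vector Carrier n} → (∀ i → f i ≈ 0#) → sum f ≈ 0#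
  sum-zero {n} f≈0 = trans (sum-cong-≋ f≈0) (sum-replicate-zero n)

  sum-single : ∀ {n} (i : Fin (suc n)) (f : Vector Carrier (suc n)) →
               (∀ s → f (punchIn i s) ≈ 0#) → sum f ≈ f i
  sum-single i f f≈0 =
    trans (sum-remove {i = i} f) (trans (+-congˡ (sum-zero f≈0)) (+-identityʳ _))

  per : ∀ {n} → Matrix n n → Carrier
  -- The permanent of `P` with the row `x` put on top. It is also the pairing of `x` with the vector
  -- of maximal subpermanents of `P`, and so expresses a matrix row applied to a vector of minors.
  expand : ∀ {n} → Vector Carrier (suc n) → Matrix n (suc n) → Carrier

  per {zero}  M = 1#
  per {suc n} M = expand (M zero) (M ∘ suc)

  expand x P = sum λ k → x k * per λ r s → P r (punchIn k s)

  per-cong : ∀ {n} {M P : Matrix n n} → (∀ i j → M i j ≈ P i j) → per M ≈ per P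
  per-cong {zero}  _   = refl
  per-cong {suc n} M≈P =
    sum-cong-≋ λ k → *-cong (M≈P zero k) (per-cong λ r s → M≈P (suc r) (punchIn k s))

  expand-congʳ : ∀ {n} (x : Vector Carrier (suc n)) {M P : Matrix n (suc n)} →
                 (∀ i j → M i j ≈ P i j) → expand x M ≈ expand x P
  expand-congʳ x M≈P =
    sum-cong-≋ λ k → *-congˡ {x k} (per-cong λ r s → M≈P r (punchIn k s))

  module _ (char2 : HasCharacteristic 2) where

    x+x≈0 : ∀ x → x + x ≈ 0#
    x+x≈0 x = begin
      x + x                      ≈⟨ +-cong (*-identityʳ x) (*-identityʳ x) ⟨
      x * 1# + x * 1#            ≈⟨ distribˡ x 1# 1# ⟨
      x * (1# + 1#)              ≈⟨ *-congˡ (+-congˡ (+-identityʳ 1#)) ⟨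
      x * (1# + (1# + 0#))       ≈⟨ *-congˡ (Equivalence.from (char2 2) ∣-refl) ⟩
      x * 0#                     ≈⟨ zeroʳ x ⟩
      0#                         ∎

    x+y≈0⇒x≈y : ∀ {x y} → x + y ≈ 0# → x ≈ y
    x+y≈0⇒x≈y {x} {y} x+y≈0 = begin
      x           ≈⟨ +-identityʳ x ⟨
      x + 0#      ≈⟨ +-congˡ (x+x≈0 y) ⟨
      x + (y + y) ≈⟨ +-assoc x y y ⟨
      x + y + y   ≈⟨ +-congʳ x+y≈0 ⟩
      0# + y      ≈⟨ +-identityˡ y ⟩
      y           ∎

    -1^k≈1 : ∀ k → (- 1#) ^ k ≈ 1#
    -1^k≈1 zero    = refl
    -1^k≈1 (suc k) =
      trans (*-cong (x+y≈0⇒x≈y (-‿inverseˡ 1#)) (-1^k≈1 k)) (*-identityˡ 1#)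

    det≈per : ∀ {n} (M : Matrix n n) → det M ≈ per M
    det≈per {zero}  M = refl
    det≈per {suc n} M = sum-cong-≋ λ k → trans
      (*-cong (-1^k≈1 (toℕ k)) (*-congˡ {M zero k} (det≈per λ r s → M (suc r) (punchIn k s))))
      (*-identityˡ _)

    -- The third argument of F enumerates the columns other than the first two.
    sum-symmetric-pairs≈0 : ∀ {n} (F : (a b : Fin (suc (suc n))) →
                                       (Fin n → Fin (suc (suc n))) → Carrier) →
      (∀ a b {g h} → g ≗ h → F a b g ≈ F a b h) →
      (∀ a b g → F a b g ≈ F b a g) →
      (sum λ j → sum λ k → F j (punchIn j k) (punchIn j ∘ punchIn k)) ≈ 0#
    sum-symmetric-pairs≈0 {n} F F-cong F-sym = begin
      -- `X` collects the pairs whose first entry is zero, `Y` those whose second entry is zero, `Z`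
      -- the rest. By symmetry `Y` repeats `X`, and the two cancel.
      X + (sum λ j → Y j + Z j)    ≈⟨ +-congˡ (∑-distrib-+ Y Z) ⟩
      X + (sum Y + sum Z)          ≈⟨ +-congˡ (+-congʳ Y≈X) ⟩
      X + (X + sum Z)              ≈⟨ +-assoc X X (sum Z) ⟨
      X + X + sum Z                ≈⟨ +-cong (x+x≈0 X) (Z≈0 F F-cong F-sym) ⟩
      0# + 0#                      ≈⟨ +-identityˡ 0# ⟩
      0#                           ∎
      where
      X = sum λ k → F zero (suc k) (suc ∘ punchIn k)
      Y Z : Fin (suc n) → Carrier
      Y j = F (suc j) zero (suc ∘ punchIn j)
      Z j = sum λ k → F (suc j) (suc (punchIn j k)) (punchIn (suc j) ∘ punchIn (suc k))
      Y≈X : sum Y ≈ X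
      Y≈X = sum-cong-≋ λ j → F-sym (suc j) zero (suc ∘ punchIn j)
      lift : ∀ {n} → (Fin n → Fin (suc (suc n))) → Fin (suc n) → Fin (suc (suc (suc n)))
      lift g zero    = zero
      lift g (suc s) = suc (g s)
      lift-cong : ∀ {n} {g h : Fin n → Fin (suc (suc n))} → g ≗ h → lift g ≗ lift h
      lift-cong g≗h zero    = ≡.refl
      lift-cong g≗h (suc s) = ≡.cong suc (g≗h s)
      Z≈0 : ∀ {n} (F : (a b : Fin (suc (suc n))) → (Fin n → Fin (suc (suc n))) → Carrier) →
        (∀ a b {g h} → g ≗ h → F a b g ≈ F a b h) →
        (∀ a b g → F a b g ≈ F b a g) →
        (sum λ j → sum λ k →
          F (suc j) (suc (punchIn j k)) (punchIn (suc j) ∘ punchIn (suc k))) ≈ 0#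
      Z≈0 {zero}  F _ _ = +-identityˡ 0#
      Z≈0 {suc n} F F-cong F-sym = trans
        -- With both chosen columns nonzero, column zero is the first of the remaining ones. `lift`
        -- puts it back, so the claim one size smaller applies.
        (sum-cong-≋ λ j → sum-cong-≋ λ k → F-cong (suc j) (suc (punchIn j k))
          {punchIn (suc j) ∘ punchIn (suc k)} {lift (punchIn j ∘ punchIn k)}
          (λ { zero → ≡.refl ; (suc s) → ≡.refl }))
        (sum-symmetric-pairs≈0 (λ a b g → F (suc a) (suc b) (lift g))
          (λ a b g≗h → F-cong (suc a) (suc b) (lift-cong g≗h))
          (λ a b g → F-sym (suc a) (suc b) (lift g)))

    module _ {n} (P : Matrix n (suc (suc n))) where

      -- A summand of the Laplace expansion along two top rows. Keeping `g` apart from `a` and `b`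
      -- lets these two be exchanged while the other columns stay fixed.
      term : (x y : Vector Carrier (suc (suc n))) (a b : Fin (suc (suc n))) →
             (Fin n → Fin (suc (suc n))) → Carrier
      term x y a b g = x a * (y b * per λ r s → P r (g s))

      term-cong : ∀ x y a b {g h} → g ≗ h → term x y a b g ≈ term x y a b h
      term-cong x y a b g≗h =
        *-congˡ (*-congˡ (per-cong λ r s → reflexive (≡.cong (P r) (g≗h s))))

      expand-∷ : ∀ x y → expand x (y ∷ P) ≈
                 sum λ j → sum λ k → term x y j (punchIn j k) (punchIn j ∘ punchIn k)
      expand-∷ x y = sum-cong-≋ λ j → *-distribˡ-sum (x j) λ k →
        y (punchIn j k) * per λ r s → P r (punchIn j (punchIn k s))

      -- For equal top rows, the choices of columns `a`, `b` and `b`, `a` give the same summand, so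
      -- they cancel in pairs.
      expand-equal : ∀ x → expand x (x ∷ P) ≈ 0#
      expand-equal x = trans (expand-∷ x x)
        (sum-symmetric-pairs≈0 (term x x) (term-cong x x) (λ a b g → x*yz≈y*xz _ _ _))

      -- The sum of the two sides has summands symmetric in the two chosen columns, hence vanishes;
      -- in characteristic 2 this is equality.
      expand-swap : ∀ x y → expand x (y ∷ P) ≈ expand y (x ∷ P)
      expand-swap x y = x+y≈0⇒x≈y (begin
        expand x (y ∷ P) + expand y (x ∷ P)
          ≈⟨ +-cong (expand-∷ x y) (expand-∷ y x) ⟩
        sum (λ j → sum (f j)) + sum (λ j → sum (g j))
          ≈⟨ ∑-distrib-+ (sum ∘ f) (sum ∘ g) ⟨
        (sum λ j → sum (f j) + sum (g j))
          ≈⟨ sum-cong-≋ (λ j → ∑-distrib-+ (f j) (g j)) ⟨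
        (sum λ j → sum λ k → f j k + g j k)
          ≈⟨ sum-symmetric-pairs≈0 (λ a b h → term x y a b h + term y x a b h)
               (λ a b h≗ → +-cong (term-cong x y a b h≗) (term-cong y x a b h≗))
               (λ a b h → trans (+-comm _ _)
                 (+-cong (x*yz≈y*xz _ _ _) (x*yz≈y*xz _ _ _))) ⟩
        0# ∎)
        where
        f g : Fin (suc (suc n)) → Fin (suc n) → Carrier
        f j k = term x y j (punchIn j k) (punchIn j ∘ punchIn k)
        g j k = term y x j (punchIn j k) (punchIn j ∘ punchIn k)

    -- Induction in the minors of the first row brings row `i` to second place; exchanging the two
    -- top rows then brings it to the top.
    per-expand : ∀ {n} (i : Fin (suc n)) (M : Matrix (suc n) (suc n)) →
                 per M ≈ expand (M i) (M ∘ punchIn i)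
    per-expand zero M = refl
    per-expand {suc n} (suc i) M = begin
      per M
        ≈⟨ sum-cong-≋ (λ k → *-congˡ {M zero k} (per-expand i λ r s → M (suc r) (punchIn k s))) ⟩
      expand (M zero) (M (suc i) ∷ M ∘ suc ∘ punchIn i)
        ≈⟨ expand-swap (M ∘ suc ∘ punchIn i) (M zero) (M (suc i)) ⟩
      expand (M (suc i)) (M zero ∷ M ∘ suc ∘ punchIn i)
        ≈⟨ expand-congʳ (M (suc i)) {M zero ∷ M ∘ suc ∘ punchIn i} {M ∘ punchIn (suc i)}
             (λ { zero s → refl ; (suc r) s → refl }) ⟩
      expand (M (suc i)) (M ∘ punchIn (suc i)) ∎

    expand-repeated : ∀ {n} (P : Matrix n (suc n)) (r : Fin n) → expand (P r) P ≈ 0#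
    expand-repeated {suc n} P r = trans
      (sum-cong-≋ λ k → *-congˡ {P r k} (per-expand r λ r s → P r (punchIn k s)))
      (expand-equal (P ∘ punchIn r) (P r))

    -- Cofactors, Cramer's rule and singular symmetric matrices.

    subminor : ∀ {n} → Matrix (suc n) (suc n) → Fin (suc n) → Fin (suc n) → Carrier
    subminor M i k = per λ r s → M (punchIn i r) (punchIn k s)

    -- Pair the relations with the `k`-th row of cofactors. The coefficient of `u s` becomes, by
    -- symmetry, row `s` expanded against the cofactors of row `k`: a permanent with a repeated row
    -- unless `s` is `k`, when it is `per M`.
    cramer : ∀ {n} (M : Matrix n n) → Symmetric M → (u : Vector Carrier n) →
             (∀ r → (sum λ s → M r s * u s) ≈ 0#) → ∀ k → per M * u k ≈ 0#
    cramer {suc n} M M-sym u Mu≈0 k = sym (begin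
      0#
        ≈⟨ sum-zero (λ r → trans (*-congˡ (Mu≈0 r)) (zeroʳ (a r))) ⟨
      (sum λ r → a r * sum λ s → M r s * u s)
        ≈⟨ sum-cong-≋ (λ r → *-distribˡ-sum (a r) (λ s → M r s * u s)) ⟩
      (sum λ r → sum λ s → a r * (M r s * u s))
        ≈⟨ ∑-comm (λ r s → a r * (M r s * u s)) ⟩
      (sum λ s → sum λ r → a r * (M r s * u s))
        ≈⟨ sum-cong-≋ (λ s → sum-cong-≋ λ r →
             trans (x*yz≈z*yx (a r) (M r s) (u s)) (*-congˡ (*-congʳ (M-sym r s)))) ⟩
      (sum λ s → sum λ r → u s * (M s r * a r))
        ≈⟨ sum-cong-≋ (λ s → *-distribˡ-sum (u s) (λ r → M s r * a r)) ⟨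
      (sum λ s → u s * expand (M s) (M ∘ punchIn k))
        ≈⟨ sum-single k (λ s → u s * expand (M s) (M ∘ punchIn k)) (λ s →
             trans (*-congˡ (expand-repeated (M ∘ punchIn k) s)) (zeroʳ _)) ⟩
      u k * expand (M k) (M ∘ punchIn k)
        ≈⟨ *-congˡ (per-expand k M) ⟨
      u k * per M
        ≈⟨ *-comm _ _ ⟩
      per M * u k ∎)
      where
      a : Vector Carrier (suc n)
      a = subminor M k

    -- For `r` equal to `i` the pairing is `per M`; otherwise it is a permanent in which row `r`
    -- occurs twice.
    singular⇒subminors-in-kernel : ∀ {n} (M : Matrix (suc n) (suc n)) → per M ≈ 0# →
      ∀ i r → expand (M r) (M ∘ punchIn i) ≈ 0#
    singular⇒subminors-in-kernel M M≈0 i r with i ≟ r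
    ... | yes ≡.refl = trans (sym (per-expand i M)) M≈0
    ... | no i≢r = ≡.subst (λ t → expand (M t) (M ∘ punchIn i) ≈ 0#)
      (punchIn-punchOut i≢r) (expand-repeated (M ∘ punchIn i) (punchOut i≢r))

    singular⇒subminor-identity : ∀ {n} (M : Matrix (suc n) (suc n)) → Symmetric M →
      per M ≈ 0# → ∀ i j → let m = subminor M in
      m j j * (m j j * m i i) ≈ m j j * (m i j * m j i)
    singular⇒subminor-identity {n} M M-sym M≈0 i j =
      x+y≈0⇒x≈y (trans (sym (distribˡ (w j) _ _)) (wⱼuᵢ≈0 i))
      where
      v w u : Vector Carrier (suc n)
      v = subminor M i
      w = subminor M j
      u k = w j * v k + v j * w k

      uⱼ≈0 : u j ≈ 0#
      uⱼ≈0 = trans (+-congʳ (*-comm _ _)) (x+x≈0 _)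

      Mu≈0 : ∀ r → (sum λ s → M r s * u s) ≈ 0#
      Mu≈0 r = begin
        (sum λ s → M r s * u s)
          ≈⟨ sum-cong-≋ (λ s → trans (distribˡ (M r s) (w j * v s) (v j * w s))
               (+-cong (x*yz≈y*xz (M r s) (w j) (v s)) (x*yz≈y*xz (M r s) (v j) (w s)))) ⟩
        (sum λ s → w j * (M r s * v s) + v j * (M r s * w s))
          ≈⟨ ∑-distrib-+ (λ s → w j * (M r s * v s)) (λ s → v j * (M r s * w s)) ⟩
        (sum λ s → w j * (M r s * v s)) + (sum λ s → v j * (M r s * w s))
          ≈⟨ +-cong (*-distribˡ-sum (w j) (λ s → M r s * v s))
                    (*-distribˡ-sum (v j) (λ s → M r s * w s)) ⟨
        w j * expand (M r) (M ∘ punchIn i) + v j * expand (M r) (M ∘ punchIn j)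
          ≈⟨ +-cong (trans (*-congˡ (singular⇒subminors-in-kernel M M≈0 i r)) (zeroʳ _))
                    (trans (*-congˡ (singular⇒subminors-in-kernel M M≈0 j r)) (zeroʳ _)) ⟩
        0# + 0#
          ≈⟨ +-identityˡ 0# ⟩
        0# ∎

      wⱼu≈0-off-j : ∀ k → w j * u (punchIn j k) ≈ 0#
      -- `w j` is by definition the permanent of `M` without row and column `j`.
      wⱼu≈0-off-j = cramer (λ r s → M (punchIn j r) (punchIn j s))
        (λ r s → M-sym (punchIn j r) (punchIn j s)) (u ∘ punchIn j) λ r → begin
          (sum λ s → M (punchIn j r) (punchIn j s) * u (punchIn j s))
            ≈⟨ +-identityˡ _ ⟨
          0# + (sum λ s → M (punchIn j r) (punchIn j s) * u (punchIn j s))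
            -- Since `u j` vanishes, restoring column `j` leaves the sum unchanged.
            ≈⟨ +-congʳ (trans (*-congˡ uⱼ≈0) (zeroʳ _)) ⟨
          M (punchIn j r) j * u j +
            (sum λ s → M (punchIn j r) (punchIn j s) * u (punchIn j s))
            ≈⟨ sum-remove {i = j} (λ s → M (punchIn j r) s * u s) ⟨
          (sum λ s → M (punchIn j r) s * u s)
            ≈⟨ Mu≈0 (punchIn j r) ⟩
          0# ∎

      wⱼuᵢ≈0 : ∀ k → w j * u k ≈ 0#
      wⱼuᵢ≈0 k with j ≟ k
      ... | yes ≡.refl = trans (*-congˡ uⱼ≈0) (zeroʳ _)
      ... | no j≢k = ≡.subst (λ t → w j * u t ≈ 0#)
        (punchIn-punchOut j≢k) (wⱼu≈0-off-j (punchOut j≢k))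

-- Nonvanishing of minors over a Heyting field.

module _ {c ℓ₁ ℓ₂} (F : HeytingField c ℓ₁ ℓ₂) where
  open HeytingField F
  open EprSequence F
  open HeytingProperties heytingCommutativeRing
    using (invertibleˡ⇒#; x-0≈x; #-congʳ; x#0y#0→xy#0)
  open Permanent (HeytingCommutativeRing.commutativeRing heytingCommutativeRing)

  -- Apartness from zero amounts to invertibility: if `z` inverts `x * y`, then `z * x` inverts `y`.
  xy#0→y#0 : ∀ {x y} → x * y # 0# → y # 0#
  xy#0→y#0 {x} {y} xy#0 =
    let z , z*xy≈1 , _ = #⇒invertible xy#0
    in invertibleˡ⇒# (z * x , trans (*-congˡ (x-0≈x y)) (trans (*-assoc z x y)
         (trans (*-congˡ (sym (x-0≈x (x * y)))) z*xy≈1)))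

  xy#0→x#0 : ∀ {x y} → x * y # 0# → x # 0#
  xy#0→x#0 {x} {y} xy#0 = xy#0→y#0 (#-congʳ (*-comm x y) xy#0)

  letterAt : ∀ {n} (B : Matrix n n) (ℓ : Vec Letter n) → IsEpr B ℓ →
             ∀ {k a} → ℓ ⟨ k ⟩≡ a → HasLetter B k a
  letterAt B ℓ epr (i , i+1≡k , ℓᵢ≡a) = ≡.subst₂ (HasLetter B) i+1≡k ℓᵢ≡a (epr i)

  allNonzero : ∀ {n k} (B : Matrix n n) → HasLetter B k A → AllNonzero B k
  allNonzero _ (all p) = p

  allZero : ∀ {n k} (B : Matrix n n) → HasLetter B k N → AllZero B k
  allZero _ (none p) = p

  -- The index sets omit single indices `i` and `j`. The left side of the subminor identity is a
  -- product of principal minors, hence nonzero; so is the right side, and with it the factor that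
  -- is the given minor.
  singular⇒minors#0 : HasCharacteristic 2 → ∀ {n} (B : Matrix (suc n) (suc n)) →
    Symmetric B → AllNonzero B n → det B ≈ 0# →
    (α β : IndexSet n (suc n)) → minor B α β # 0#
  singular⇒minors#0 char2 {n} B B-sym nonzero detB≈0 (f , f-mono) (g , g-mono) =
    let i , f≗ = increasing≗punchIn f f-mono
        j , g≗ = increasing≗punchIn g g-mono
        mⱼⱼ#0 = diagonal#0 j
        product#0 = x#0y#0→xy#0 mⱼⱼ#0 (x#0y#0→xy#0 mⱼⱼ#0 (diagonal#0 i))
        identity = singular⇒subminor-identity char2 B B-sym perB≈0 i j
    in #-congʳ
         (sym (trans (det≈per char2 λ r s → B (f r) (g s))
           (per-cong λ r s → reflexive (≡.cong₂ B (f≗ r) (g≗ s)))))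
         (xy#0→x#0 (xy#0→y#0 (#-congʳ identity product#0)))
    where
    perB≈0 : per B ≈ 0#
    perB≈0 = trans (sym (det≈per char2 B)) detB≈0
    diagonal#0 : ∀ i → subminor char2 B i i # 0#
    diagonal#0 i = #-congʳ (det≈per char2 λ r s → B (punchIn i r) (punchIn i s))
      (nonzero (punchIn i , punchIn-mono-< i))

lemma2p4 : ∀ {c ℓ₁ ℓ₂} (F : HeytingField c ℓ₁ ℓ₂) →
    let open HeytingField F
        open EprSequence F
    in HasCharacteristic 2 →
       (n : ℕ) → 2 ≤ n →
       (B : Matrix n n) → Symmetric B →
       (ℓ : Vec Letter n) → IsEpr B ℓ →
       ℓ ⟨ n ∸ 1 ⟩≡ A → ℓ ⟨ n ⟩≡ N →
       (α β : IndexSet (n ∸ 1) n) → minor B α β # 0#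
lemma2p4 F char2 (suc n) _ B B-sym ℓ epr ℓₙ₋₁≡A ℓₙ≡N =
  singular⇒minors#0 F char2 B B-sym
    (allNonzero F B (letterAt F B ℓ epr ℓₙ₋₁≡A))
    -- The identity enumerates the full index set, whose principal minor is `det B`.
    (allZero F B (letterAt F B ℓ epr ℓₙ≡N) (id , id))
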